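{- Let $E$ be a finite set and let $\tau:2^E\to 2^E$ be a closure operator with set of closed sets $\mathcal{L}\subseteq 2^E$. Then cover-closure $\xi:\mathcal{L}\to\mathcal{L}$, $\xi(X)=\tau(\mathrm{cov}(X))$, is bijective if and only if $\mathcal{L}$ is isomorphic to the set of order ideals $J(P)$ for some poset $P$.
   Context: A closure operator on $E$ is a function $\tau:2^E\to 2^E$ such that for all $X,Y\subseteq E$: $X\subseteq\tau(X)$; $X\subseteq Y$ implies $\tau(X)\subseteq\tau(Y)$; and $\tau(\tau(X))=\tau(X)$. A set $X\subseteq E$ is closed if $\tau(X)=X$. For $X\in 2^E$, $\mathrm{cov}(X)=\{e\in E\setminus X\mid X\cup\{e\}\in\mathcal{L}\}$. Cover-closure is the map $\xi:\mathcal{L}\to\mathcal{L}$ given by $\xi(X)=\tau(\mathrm{cov}(X))$. An order ideal of a poset $P$ is a subset $I\subseteq P$ such that $y\in I$ and $x\le y$ imply $x\in I$; $J(P)\subseteq 2^P$ is the set of order ideals of $P$. An essentialization of $(\mathcal{L},E)$, for $\mathcal{L}\subseteq 2^E$, is a pair $(\mathcal{L}',E')$ obtained as follows. Every $e\in E'$ must be an element of $E$ such that there exist $X,Y\in\mathcal{L}$ with $e\in X$ and $e\notin Y$. Also, if $Z\subseteq E$, $|Z|>1$, is such that whenever $e\in Z$ and $e\in W\in\mathcal{L}$ we have $Z\subseteq W$, then for any maximal such $Z$ all elements of $Z$ except one are excluded from $E'$. All other elements of $E$ are kept in $E'$. Finally $\mathcal{L}'=\{X\cap E'\mid X\in\mathcal{L}\}$.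 Families $\mathcal{L}_1\subseteq 2^{E_1}$ and $\mathcal{L}_2\subseteq 2^{E_2}$ are isomorphic if there exists a bijection $\varphi:E_1'\to E_2'$ such that $\varphi(\mathcal{L}_1')=\mathcal{L}_2'$.
   Formalization: The "if" direction is proved only when no two distinct elements outside τ(∅) lie in exactly the same closed sets; without this it fails, e.g. E={a,b} with closed sets ∅ and E, where L is isomorphic to J(one point) but ξ is constantly ∅. -}

module Defs where

open import Data.Bool.Base using (Bool; T)
import Data.Bool.Properties as Bool
open import Data.Fin.Base using (Fin)
open import Data.Fin.Subset using (Subset; _⊆_; _∪_; ⁅_⁆)
open import Data.Fin.Subset.Properties using (_∈?_)
open import Data.Nat.Base using (ℕ)
open import Data.Product.Base using (Σ; Σ-syntax; ∃; ∃-syntax; _×_; _,_; proj₁)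
open import Data.Vec.Base using (tabulate)
open import Data.Vec.Properties using (≡-dec)
open import Function.Base using (_∘_)
open import Function.Bundles using (_↔_; _⇔_; Inverse)
import Function.Definitions as FD
open import Level using (0ℓ)
open import Relation.Binary.Core using (Rel)
open import Relation.Binary.Definitions using (DecidableEquality)
open import Relation.Binary.PropositionalEquality using (_≡_; _≢_; _≗_)
open import Relation.Binary.Structures using (IsPartialOrder)
open import Relation.Nullary.Decidable using (does; ¬?; _×-dec_)
open import Relation.Nullary.Negation using (¬_)
open import Relation.Unary using (Pred)

private
  variable
    n : ℕ
    A B : Set

-- The ground set of a closure operator is Fin n, with the library's
-- Subset n.  The poset P need not be presented as some Fin m, so families
-- that are compared up to isomorphism live on an arbitrary type A, with
-- Boolean characteristic functions as subsets.

infixr 9 2^_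
2^_ : Set → Set
2^ A = A → Bool

infix 4 _∈ₛ_ _∉ₛ_ _⊆ₛ_
_∈ₛ_ : A → 2^ A → Set
a ∈ₛ S = T (S a)

_∉ₛ_ : A → 2^ A → Set
a ∉ₛ S = ¬ (a ∈ₛ S)

_⊆ₛ_ : 2^ A → 2^ A → Set
S ⊆ₛ S′ = ∀ {a} → a ∈ₛ S → a ∈ₛ S′

SetFamily : Set → Set₁
SetFamily A = Pred (2^ A) 0ℓ

record IsClosureOperator (τ : Subset n → Subset n) : Set where
  field
    extensive  : ∀ X → X ⊆ τ X
    monotone   : ∀ {X Y} → X ⊆ Y → τ X ⊆ τ Y
    idempotent : ∀ X → τ (τ X) ≡ τ X

IsClosed : (Subset n → Subset n) → Subset n → Set
IsClosed τ X = τ X ≡ X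

ClosedSet : (Subset n → Subset n) → Set
ClosedSet {n} τ = Σ[ X ∈ Subset n ] IsClosed τ X

infix 4 _≈ᶜ_
_≈ᶜ_ : {τ : Subset n → Subset n} → Rel (ClosedSet τ) 0ℓ
X ≈ᶜ Y = proj₁ X ≡ proj₁ Y

closedSets : (Subset n → Subset n) → SetFamily (Fin n)
closedSets τ S = IsClosed τ (tabulate S)

infix 4 _≟ₛ_
_≟ₛ_ : DecidableEquality (Subset n)
_≟ₛ_ = ≡-dec Bool._≟_

cov : (Subset n → Subset n) → Subset n → Subset n
cov τ X = tabulate λ e →
  does (¬? (e ∈? X) ×-dec (τ (X ∪ ⁅ e ⁆) ≟ₛ X ∪ ⁅ e ⁆))

coverClosure : {τ : Subset n → Subset n} → IsClosureOperator τ →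
               ClosedSet τ → ClosedSet τ
coverClosure {τ = τ} isClosure (X , _) =
  τ (cov τ X) , IsClosureOperator.idempotent isClosure (cov τ X)

CoverClosureBijective : {τ : Subset n → Subset n} → IsClosureOperator τ → Set
CoverClosureBijective {τ = τ} isClosure =
  FD.Bijective (_≈ᶜ_ {τ = τ}) (_≈ᶜ_ {τ = τ}) (coverClosure isClosure)

orderIdeals : {P : Set} → Rel P 0ℓ → SetFamily P
orderIdeals _≤_ I = ∀ {x y} → y ∈ₛ I → x ≤ y → x ∈ₛ I

-- e lies in some member of the family, but not in all of them.
Distinguished : SetFamily A → A → Set
Distinguished ℒ e =
  (∃[ X ] ℒ X × e ∈ₛ X) × (∃[ Y ] ℒ Y × e ∉ₛ Y)

-- The members of Z only ever occur in ℒ all together.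
Inseparable : SetFamily A → 2^ A → Set
Inseparable ℒ Z = ∀ {e W} → e ∈ₛ Z → ℒ W → e ∈ₛ W → Z ⊆ₛ W

-- The maximal Z with |Z| > 1.  Any superset of Z again has at least two
-- elements, so Z′ needs no separate size condition.
record IsBlock (ℒ : SetFamily A) (Z : 2^ A) : Set where
  field
    inseparable : Inseparable ℒ Z
    size>1      : ∃[ e ] ∃[ f ] e ∈ₛ Z × f ∈ₛ Z × e ≢ f
    maximal     : ∀ {Z′} → Inseparable ℒ Z′ → Z ⊆ₛ Z′ → Z′ ⊆ₛ Z

-- In `block`, r is the one element of Z that Z does not exclude.  It may
-- still be excluded by `distinguished`, as happens when Z is the set of
-- elements common to all members of ℒ.
record IsEssentialization (ℒ : SetFamily A) (E′ : 2^ A) : Set where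
  field
    distinguished : ∀ {e} → e ∈ₛ E′ → Distinguished ℒ e
    block         : ∀ {Z} → IsBlock ℒ Z →
                    ∃[ r ] r ∈ₛ Z
                         × (∀ {f} → f ∈ₛ Z → f ≢ r → f ∉ₛ E′)
                         × (Distinguished ℒ r → r ∈ₛ E′)
    others        : ∀ {e} → Distinguished ℒ e →
                    (∀ {Z} → IsBlock ℒ Z → e ∉ₛ Z) → e ∈ₛ E′

Elem : 2^ A → Set
Elem E′ = Σ[ e ∈ _ ] e ∈ₛ E′

-- { X ∩ E′ ∣ X ∈ ℒ }, as a family of subsets of E′.
infixl 7 _↾_
_↾_ : SetFamily A → (E′ : 2^ A) → SetFamily (Elem E′)
(ℒ ↾ E′) S = ∃[ X ] ℒ X × S ≗ X ∘ proj₁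

-- The direct image of S; its characteristic function is that of S
-- precomposed with the inverse bijection.
image : A ↔ B → 2^ A → 2^ B
image φ S = S ∘ Inverse.from φ

imageFamily : A ↔ B → SetFamily A → SetFamily B
imageFamily φ ℒ S = ∃[ X ] ℒ X × S ≗ image φ X

infix 4 _≅_
_≅_ : SetFamily A → SetFamily B → Set
_≅_ {A} {B} ℒ₁ ℒ₂ =
  Σ[ E₁′ ∈ 2^ A ] Σ[ E₂′ ∈ 2^ B ]
    IsEssentialization ℒ₁ E₁′ ×
    IsEssentialization ℒ₂ E₂′ ×
    Σ[ φ ∈ Elem E₁′ ↔ Elem E₂′ ]
      (∀ S → imageFamily φ (ℒ₁ ↾ E₁′) S ⇔ (ℒ₂ ↾ E₂′) S)

IsomorphicToOrderIdeals : SetFamily A → Set₁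
IsomorphicToOrderIdeals ℒ =
  Σ Set λ P → Σ (Rel P 0ℓ) λ _≤_ →
    IsPartialOrder _≡_ _≤_ × (ℒ ≅ orderIdeals _≤_)

-- Passing to an essentialization removes nothing but undistinguished
-- elements: a distinguished element is not doubled by any other one.
--
-- Cover-closure is not invariant under essentialization: it adds one
-- element at a time, so it never sees doubled elements.  For instance on
-- E = {a, b} with closed sets ∅ and E, the essentialization is that of the
-- order ideals of a one-element poset, but cov is empty everywhere and
-- cover-closure is constantly ∅.
NoDoubledElements : SetFamily A → Set
NoDoubledElements ℒ =
  ∀ {Z e f} → Inseparable ℒ Z → e ∈ₛ Z → f ∈ₛ Z → Distinguished ℒ e → e ≡ f

{-# OPTIONS --safe #-}
-- Write x ≼ y for x ∈ τ {y}.  Both sides of the equivalence say that ≼ is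
-- antisymmetric outside τ ∅ and that every ≼-down-closed set containing τ ∅ is
-- closed.
--
-- If ξ is injective, then ξ X ≠ τ ∅ = ξ E for closed X ≠ E, so every such X is
-- extended to another closed set by one element.  Hence for e outside a closed
-- set Y, any maximal closed set M ⊇ Y avoiding e has cov M = {e} and
-- ξ M = τ {e}.  By injectivity M depends only on e, so M is the largest closed
-- set that avoids e; a union of closed sets avoiding e then lies in M.
--
-- Conversely, an isomorphism with J(P) makes closed sets stable under unions,
-- and for order ideals ξ sends X to the ideal generated by the minimal elements
-- of the complement of X.  Since cov X is the set of maximal elements of ξ X
-- outside τ ∅, this can be undone.
module Submission where

open import Defs
open import Data.Bool.Base using (true; false; T; _∨_)
open import Data.Bool.Properties using (T-≡; T-∨; T-irrelevant; T?)
open import Data.Fin.Base using (Fin)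
import Data.Fin.Induction as Fin
open import Data.Fin.Properties using (_≟_; any?; all?)
open import Data.Fin.Subset using (Subset; _∈_; _∉_; _⊆_; _⊂_; _∪_; ⁅_⁆; ⊥; ⊤)
open import Data.Fin.Subset.Induction using (⊃-wellFounded)
open import Data.Fin.Subset.Properties
  using ( _∈?_; _⊆?_; ⊆-antisym; ⊆-refl; ⊆-trans; ⊥⊆; ⊆⊤; ∈⊤; x∈⁅x⁆; x∈⁅y⁆⇒x≡y
        ; p⊆p∪q; q⊆p∪q; x∈p∪q⁻; x∈p∪q⁺)
open import Data.Nat.Base using (ℕ)
open import Data.Product.Base using (∃-syntax; _×_; _,_; proj₁; proj₂)
open import Data.Sum.Base using (inj₁; inj₂; [_,_]′)
import Data.Sum.Base as Sum
open import Data.Unit.Base using (tt)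
open import Data.Vec.Base using (tabulate; lookup)
open import Data.Vec.Properties
  using (lookup∘tabulate; tabulate∘lookup; tabulate-cong; lookup-zipWith; []=⇒lookup; lookup⇒[]=)
open import Function.Base using (_∘_; flip; const; _$_)
open import Function.Bundles using (_↔_; mk⇔; mk↔ₛ′; Equivalence; Inverse)
open import Induction.WellFounded using (WellFounded; Acc; acc)
open import Level using (0ℓ)
open import Relation.Binary.Core using (Rel)
open import Relation.Binary.PropositionalEquality
  using (_≡_; _≢_; _≗_; refl; sym; trans; cong; cong₂; subst; isEquivalence; resp₂; module ≡-Reasoning)
open import Relation.Binary.Structures using (IsPartialOrder; IsStrictPartialOrder)
open import Relation.Nullary.Decidable
  using (Dec; yes; no; does; map′; does-⇔; decidable-stable; ¬?; _×-dec_; _→-dec_)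
open import Relation.Nullary.Negation using (¬_; contradiction)
open import Relation.Unary using (Pred; Decidable)

private
  variable
    n : ℕ
    A : Set

-- Decidable predicates and the two encodings of subsets

does⁺ : (a? : Dec A) → A → T (does a?)
does⁺ (yes _) _ = tt
does⁺ (no ¬a) a = ¬a a

does⁻ : (a? : Dec A) → T (does a?) → A
does⁻ (yes a) _ = a

∈-tabulate⁺ : (S : 2^ Fin n) {e : Fin n} → e ∈ₛ S → e ∈ tabulate S
∈-tabulate⁺ S {e} e∈S =
  lookup⇒[]= e (tabulate S) (trans (lookup∘tabulate S e) (Equivalence.to T-≡ e∈S))

∈-tabulate⁻ : (S : 2^ Fin n) {e : Fin n} → e ∈ tabulate S → e ∈ₛ S
∈-tabulate⁻ S {e} e∈S =
  Equivalence.from T-≡ (trans (sym (lookup∘tabulate S e)) ([]=⇒lookup e∈S))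

∈-lookup⁺ : (X : Subset n) {e : Fin n} → e ∈ X → e ∈ₛ lookup X
∈-lookup⁺ X = Equivalence.from T-≡ ∘ []=⇒lookup

∈-lookup⁻ : (X : Subset n) {e : Fin n} → e ∈ₛ lookup X → e ∈ X
∈-lookup⁻ X {e} = lookup⇒[]= e X ∘ Equivalence.to T-≡

module _ {Q : Pred (Fin n) 0ℓ} (Q? : Decidable Q) where

  comprehension : Subset n
  comprehension = tabulate (does ∘ Q?)

  ∈-comprehension⁺ : ∀ {e} → Q e → e ∈ comprehension
  ∈-comprehension⁺ {e} q = ∈-tabulate⁺ (does ∘ Q?) (does⁺ (Q? e) q)

  ∈-comprehension⁻ : ∀ {e} → e ∈ comprehension → Q e
  ∈-comprehension⁻ {e} e∈ = does⁻ (Q? e) (∈-tabulate⁻ (does ∘ Q?) e∈)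

⊈⇒∃ : {X Y : Subset n} → ¬ (X ⊆ Y) → ∃[ e ] e ∈ X × e ∉ Y
⊈⇒∃ {X = X} {Y} X⊈Y with any? (λ e → (e ∈? X) ×-dec ¬? (e ∈? Y))
... | yes found = found
... | no ¬found =
  contradiction (λ {e} e∈X → decidable-stable (e ∈? Y) λ e∉Y → ¬found (e , e∈X , e∉Y)) X⊈Y

-- The preorder and the covers of a closure operator

module Closure {τ : Subset n → Subset n} (isClosure : IsClosureOperator τ) where
  open IsClosureOperator isClosure

  ξ : ClosedSet τ → ClosedSet τ
  ξ = coverClosure isClosure

  bottom : Subset n
  bottom = τ ⊥

  infix 4 _≼_ _≺_
  _≼_ : Rel (Fin n) 0ℓ
  x ≼ y = x ∈ τ ⁅ y ⁆

  -- As `≼` is only a preorder, strictness is failure of the converse; with `≢` instead, equivalent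
  -- elements would break well-foundedness.
  _≺_ : Rel (Fin n) 0ℓ
  x ≺ y = x ≼ y × ¬ (y ≼ x)

  _≼?_ : ∀ x y → Dec (x ≼ y)
  x ≼? y = x ∈? τ ⁅ y ⁆

  closure-least : ∀ {X Y} → IsClosed τ Y → X ⊆ Y → τ X ⊆ Y
  closure-least Y-closed X⊆Y = subst (τ _ ⊆_) Y-closed (monotone X⊆Y)

  bottom-least : ∀ {Y} → IsClosed τ Y → bottom ⊆ Y
  bottom-least Y-closed = closure-least Y-closed ⊥⊆

  ⁅⁆⊆ : ∀ {x} {Y : Subset n} → x ∈ Y → ⁅ x ⁆ ⊆ Y
  ⁅⁆⊆ {x} {Y} x∈Y z∈ = subst (_∈ Y) (sym (x∈⁅y⁆⇒x≡y x z∈)) x∈Y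

  closed-down : ∀ {x y Y} → IsClosed τ Y → y ∈ Y → x ≼ y → x ∈ Y
  closed-down Y-closed y∈Y = closure-least Y-closed (⁅⁆⊆ y∈Y)

  ≼-refl : ∀ {x} → x ≼ x
  ≼-refl {x} = extensive ⁅ x ⁆ (x∈⁅x⁆ x)

  ≼-trans : ∀ {x y z} → x ≼ y → y ≼ z → x ≼ z
  ≼-trans x≼y y≼z = closed-down (idempotent _) y≼z x≼y

  ≺-isStrictPartialOrder : IsStrictPartialOrder _≡_ _≺_
  ≺-isStrictPartialOrder = record
    { isEquivalence = isEquivalence
    ; irrefl        = λ { refl (x≼x , x⋠x) → x⋠x x≼x }
    ; trans         = λ (x≼y , y⋠x) (y≼z , _) →
                        ≼-trans x≼y y≼z , λ z≼x → y⋠x (≼-trans y≼z z≼x)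
    ; <-resp-≈      = resp₂ _≺_
    }

  ≺-wellFounded : WellFounded _≺_
  ≺-wellFounded = Fin.spo-wellFounded ≺-isStrictPartialOrder

  ≻-wellFounded : WellFounded (flip _≺_)
  ≻-wellFounded = Fin.spo-noetherian ≺-isStrictPartialOrder

  cover? : ∀ X → Decidable (λ e → e ∉ X × IsClosed τ (X ∪ ⁅ e ⁆))
  cover? X e = ¬? (e ∈? X) ×-dec (τ (X ∪ ⁅ e ⁆) ≟ₛ X ∪ ⁅ e ⁆)

  ∈cov⁺ : ∀ {X e} → e ∉ X → IsClosed τ (X ∪ ⁅ e ⁆) → e ∈ cov τ X
  ∈cov⁺ {X} e∉X closed = ∈-comprehension⁺ (cover? X) (e∉X , closed)

  ∈cov⁻ : ∀ {X e} → e ∈ cov τ X → e ∉ X × IsClosed τ (X ∪ ⁅ e ⁆)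
  ∈cov⁻ {X} = ∈-comprehension⁻ (cover? X)

  -- The closed set `X ∪ ⁅ e ⁆` contains everything below `e`. So elements of `cov τ X` are minimal
  -- outside `X`.
  cov-below : ∀ {X e y} → e ∈ cov τ X → y ∉ X → y ≼ e → y ≡ e
  cov-below {X} {e} e∈cov y∉X y≼e =
    [ (λ y∈X → contradiction y∈X y∉X) , x∈⁅y⁆⇒x≡y e ]′
      (x∈p∪q⁻ X ⁅ e ⁆ (closed-down (proj₂ (∈cov⁻ e∈cov)) (q⊆p∪q X ⁅ e ⁆ (x∈⁅x⁆ e)) y≼e))

  -- Elements of `bottom` lie below everything, hence are equivalent to each other, so antisymmetry
  -- can be asked only outside it.
  record IsOrderLike : Set where
    field
      down-closed : ∀ {S} → bottom ⊆ S → (∀ {x y} → y ∈ S → x ≼ y → x ∈ S) → IsClosed τ S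
      antisym     : ∀ {x y} → x ∉ bottom → x ≼ y → y ≼ x → x ≡ y

  -- Order ideals have bijective cover-closure

  module FromOrderLike (isOrderLike : IsOrderLike) where
    open IsOrderLike isOrderLike

    ∉bottom-up : ∀ {x y} → x ∉ bottom → x ≼ y → y ∉ bottom
    ∉bottom-up x∉ x≼y y∈ = x∉ (closed-down (idempotent ⊥) y∈ x≼y)

    -- `bottom` together with all that lies below some element of `C` is down-closed, hence closed,
    -- so it contains `τ C`.
    ∈closure⁻ : ∀ {C x} → x ∉ bottom → x ∈ τ C → ∃[ c ] c ∈ C × x ≼ c
    ∈closure⁻ {C} {x} x∉ x∈τC =
      [ (λ x∈ → contradiction x∈ x∉) , ∈-comprehension⁻ below? ]′
        (x∈p∪q⁻ bottom ideal (closure-least ideal-closed C⊆ x∈τC))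
      where
      below? : Decidable (λ z → ∃[ c ] c ∈ C × z ≼ c)
      below? z = any? (λ c → (c ∈? C) ×-dec (z ≼? c))
      ideal : Subset n
      ideal = comprehension below?
      C⊆ : C ⊆ bottom ∪ ideal
      C⊆ c∈C = q⊆p∪q bottom ideal (∈-comprehension⁺ below? (_ , c∈C , ≼-refl))
      down : ∀ {x y} → y ∈ bottom ∪ ideal → x ≼ y → x ∈ bottom ∪ ideal
      down y∈ x≼y = x∈p∪q⁺ (Sum.map
        (λ y∈bottom → closed-down (idempotent ⊥) y∈bottom x≼y)
        (λ y∈ideal → let c , c∈C , y≼c = ∈-comprehension⁻ below? y∈ideal in
           ∈-comprehension⁺ below? (c , c∈C , ≼-trans x≼y y≼c))
        (x∈p∪q⁻ bottom ideal y∈))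
      ideal-closed : IsClosed τ (bottom ∪ ideal)
      ideal-closed = down-closed (p⊆p∪q ideal) down

    extension-closed : ∀ {X e} → IsClosed τ X → (∀ {y} → y ≼ e → y ≢ e → y ∈ X) →
                       IsClosed τ (X ∪ ⁅ e ⁆)
    extension-closed {X} {e} X-closed below =
      down-closed (⊆-trans (bottom-least X-closed) (p⊆p∪q ⁅ e ⁆)) down
      where
      down : ∀ {x y} → y ∈ X ∪ ⁅ e ⁆ → x ≼ y → x ∈ X ∪ ⁅ e ⁆
      down {x} y∈ x≼y with x∈p∪q⁻ X ⁅ e ⁆ y∈
      ... | inj₁ y∈X = p⊆p∪q ⁅ e ⁆ (closed-down X-closed y∈X x≼y)
      ... | inj₂ y∈⁅e⁆ with refl ← x∈⁅y⁆⇒x≡y e y∈⁅e⁆ with x ≟ e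
      ...   | yes refl = q⊆p∪q X ⁅ e ⁆ (x∈⁅x⁆ e)
      ...   | no x≢e   = p⊆p∪q ⁅ e ⁆ (below x≼y x≢e)

    -- Strict descent from `e` outside `X` ends at a minimal element of the complement. By
    -- antisymmetry all else below it is in `X`, so it is a cover.
    cov-below-∉ : ∀ {X e} → IsClosed τ X → e ∉ X → ∃[ c ] c ∈ cov τ X × c ≼ e
    cov-below-∉ {X} {e} X-closed = descend (≺-wellFounded e)
      where
      descend : ∀ {e} → Acc _≺_ e → e ∉ X → ∃[ c ] c ∈ cov τ X × c ≼ e
      descend {e} (acc rec) e∉X
        with any? (λ y → (y ≼? e) ×-dec (¬? (e ≼? y) ×-dec ¬? (y ∈? X)))
      ... | yes (y , y≼e , e⋠y , y∉X) =
        let c , c∈cov , c≼y = descend (rec (y≼e , e⋠y)) y∉X in c , c∈cov , ≼-trans c≼y y≼e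
      ... | no minimal = e , ∈cov⁺ e∉X (extension-closed X-closed below) , ≼-refl
        where
        below : ∀ {y} → y ≼ e → y ≢ e → y ∈ X
        below {y} y≼e y≢e = decidable-stable (y ∈? X) λ y∉X →
          minimal (y , y≼e
                  , (λ e≼y → y≢e (antisym (λ y∈ → y∉X (bottom-least X-closed y∈)) y≼e e≼y))
                  , y∉X)

    cov-∉bottom : ∀ {X c} → IsClosed τ X → c ∈ cov τ X → c ∉ bottom
    cov-∉bottom X-closed c∈cov c∈ = proj₁ (∈cov⁻ c∈cov) (bottom-least X-closed c∈)

    -- `c` lies below some `d` in `cov τ Y`, and `d` below some `c′` in `cov τ X`. Minimality
    -- outside `X` makes `c′` equal to `c`, and antisymmetry makes `d` equal to `c`.
    cov-⊆ : ∀ {X Y} → IsClosed τ X → τ (cov τ X) ≡ τ (cov τ Y) → cov τ X ⊆ cov τ Y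
    cov-⊆ {X} {Y} X-closed eq {c} c∈covX =
      let c∉            = cov-∉bottom X-closed c∈covX
          d , d∈ , c≼d  = ∈closure⁻ c∉ (subst (c ∈_) eq (extensive _ c∈covX))
          c′ , c′∈ , d≼c′ = ∈closure⁻ (∉bottom-up c∉ c≼d) (subst (d ∈_) (sym eq) (extensive _ d∈))
          c≡c′          = cov-below c′∈ (proj₁ (∈cov⁻ c∈covX)) (≼-trans c≼d d≼c′)
          c≡d           = antisym c∉ c≼d (subst (d ≼_) (sym c≡c′) d≼c′)
      in subst (_∈ cov τ Y) (sym c≡d) d∈

    -- Below an element of `Y` outside `X` there would be a cover of `X`: in `Y` by down-closure,
    -- yet outside `Y` as a cover of `Y`.
    cov-determines : ∀ {X Y} → IsClosed τ X → IsClosed τ Y → cov τ X ⊆ cov τ Y → Y ⊆ X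
    cov-determines {X} X-closed Y-closed cov⊆ {e} e∈Y = decidable-stable (e ∈? X) λ e∉X →
      let c , c∈cov , c≼e = cov-below-∉ X-closed e∉X
      in proj₁ (∈cov⁻ (cov⊆ c∈cov)) (closed-down Y-closed e∈Y c≼e)

    ξ-injective : ∀ {X Y} → ξ X ≈ᶜ ξ Y → X ≈ᶜ Y
    ξ-injective {X , X-closed} {Y , Y-closed} eq = ⊆-antisym
      (cov-determines Y-closed X-closed (cov-⊆ Y-closed (sym eq)))
      (cov-determines X-closed Y-closed (cov-⊆ X-closed eq))

    module Preimage {Y : Subset n} (Y-closed : IsClosed τ Y) where

      Maximal : Pred (Fin n) 0ℓ
      Maximal c = (c ∈ Y × c ∉ bottom) × (∀ d → d ∈ Y → c ≼ d → d ≼ c)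

      maximal? : Decidable Maximal
      maximal? c = ((c ∈? Y) ×-dec ¬? (c ∈? bottom))
                   ×-dec all? (λ d → (d ∈? Y) →-dec ((c ≼? d) →-dec (d ≼? c)))

      maximals : Subset n
      maximals = comprehension maximal?

      aboveMaximal? : Decidable (λ e → ∃[ c ] Maximal c × c ≼ e)
      aboveMaximal? e = any? (λ c → maximal? c ×-dec (c ≼? e))

      -- The maximal elements of `Y` outside `bottom` have to become the minimal elements of the
      -- complement, so the complement is the up-set they generate.
      preimage : Subset n
      preimage = comprehension (¬? ∘ aboveMaximal?)

      ∈preimage⁺ : ∀ {e} → ¬ (∃[ c ] Maximal c × c ≼ e) → e ∈ preimage
      ∈preimage⁺ = ∈-comprehension⁺ (¬? ∘ aboveMaximal?)

      ∈preimage⁻ : ∀ {e} → e ∈ preimage → ¬ (∃[ c ] Maximal c × c ≼ e)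
      ∈preimage⁻ = ∈-comprehension⁻ (¬? ∘ aboveMaximal?)

      preimage-closed : IsClosed τ preimage
      preimage-closed = down-closed
        (λ e∈ → ∈preimage⁺ λ (c , ((_ , c∉) , _) , c≼e) → ∉bottom-up c∉ c≼e e∈)
        (λ y∈ x≼y → ∈preimage⁺ λ (c , max , c≼x) → ∈preimage⁻ y∈ (c , max , ≼-trans c≼x x≼y))

      -- Maximal elements are pairwise incomparable: if `y` lies below `c` and above a maximal `d`,
      -- then maximality of `d` gives `c ≼ d`, and `y` equals `c`.
      maximals⊆cov : maximals ⊆ cov τ preimage
      maximals⊆cov {c} c∈ = ∈cov⁺ (λ c∈pre → ∈preimage⁻ c∈pre (c , c-max , ≼-refl))
                                  (extension-closed preimage-closed below)
        where
        c-max : Maximal c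
        c-max = ∈-comprehension⁻ maximal? c∈
        below : ∀ {y} → y ≼ c → y ≢ c → y ∈ preimage
        below {y} y≼c y≢c = ∈preimage⁺ λ (d , ((d∈Y , d∉) , d-top) , d≼y) →
          let c≼d = d-top c (proj₁ (proj₁ c-max)) (≼-trans d≼y y≼c)
          in y≢c (antisym (∉bottom-up d∉ d≼y) y≼c (≼-trans c≼d d≼y))

      cov⊆Y : cov τ preimage ⊆ Y
      cov⊆Y {e} e∈cov with aboveMaximal? e
      ... | no ¬above = contradiction (∈preimage⁺ ¬above) (proj₁ (∈cov⁻ e∈cov))
      ... | yes (c , c-max , c≼e) = subst (_∈ Y)
        (cov-below e∈cov (λ c∈pre → ∈preimage⁻ c∈pre (c , c-max , ≼-refl)) c≼e)
        (proj₁ (proj₁ c-max))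

      below-maximal : ∀ {y} → Acc (flip _≺_) y → y ∈ Y → y ∉ bottom → ∃[ c ] Maximal c × y ≼ c
      below-maximal {y} (acc rec) y∈Y y∉
        with any? (λ d → (d ∈? Y) ×-dec ((y ≼? d) ×-dec ¬? (d ≼? y)))
      ... | yes (d , d∈Y , y≼d , d⋠y) =
        let c , c-max , d≼c = below-maximal (rec (y≼d , d⋠y)) d∈Y (∉bottom-up y∉ y≼d)
        in c , c-max , ≼-trans y≼d d≼c
      ... | no ¬larger = y , ((y∈Y , y∉) , top) , ≼-refl
        where
        top : ∀ d → d ∈ Y → y ≼ d → d ≼ y
        top d d∈Y y≼d = decidable-stable (d ≼? y) λ d⋠y → ¬larger (d , d∈Y , y≼d , d⋠y)

      Y⊆closure : Y ⊆ τ (cov τ preimage)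
      Y⊆closure {y} y∈Y with y ∈? bottom
      ... | yes y∈ = bottom-least (idempotent _) y∈
      ... | no y∉ =
        let c , c-max , y≼c = below-maximal (≻-wellFounded y) y∈Y y∉
        in closed-down (idempotent _)
             (extensive _ (maximals⊆cov (∈-comprehension⁺ maximal? c-max))) y≼c

      ξ-preimage : τ (cov τ preimage) ≡ Y
      ξ-preimage = ⊆-antisym (closure-least Y-closed cov⊆Y) Y⊆closure

    bijective : CoverClosureBijective isClosure
    bijective = (λ {X} {Y} → ξ-injective {X} {Y}) , λ (Y , Y-closed) →
      let open Preimage Y-closed
      in (preimage , preimage-closed) , λ { refl → ξ-preimage }

  -- Injective cover-closure

  module FromInjective (injective : ∀ {X Y} → ξ X ≈ᶜ ξ Y → X ≈ᶜ Y) where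

    ⊤-closed : IsClosed τ ⊤
    ⊤-closed = ⊆-antisym ⊆⊤ (extensive ⊤)

    cov⊤⊆ : ∀ {Z} → cov τ ⊤ ⊆ Z
    cov⊤⊆ e∈ = contradiction ∈⊤ (proj₁ (∈cov⁻ e∈))

    cov-nonempty : ∀ {X e} → IsClosed τ X → e ∉ X → ∃[ f ] f ∈ cov τ X
    cov-nonempty {X} {e} X-closed e∉X with any? (_∈? cov τ X)
    ... | yes found = found
    ... | no empty  = contradiction
      (subst (e ∈_) (sym (injective {X , X-closed} {⊤ , ⊤-closed} ξX≡ξ⊤)) ∈⊤) e∉X
      where
      ξX≡ξ⊤ : τ (cov τ X) ≡ τ (cov τ ⊤)
      ξX≡ξ⊤ = cong τ (⊆-antisym (λ f∈ → contradiction (_ , f∈) empty) cov⊤⊆)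

    -- The name is from convex geometries. Maximality among closed sets avoiding `e` is not built
    -- in; it comes from `copoint-largest`.
    IsCopoint : Fin n → Subset n → Set
    IsCopoint e M = IsClosed τ M × cov τ M ≡ ⁅ e ⁆

    -- Covers other than `e` are added while there are any. When none is left, `cov-nonempty` makes
    -- `e` the sole cover.
    copoint-above : ∀ {e Y} → IsClosed τ Y → e ∉ Y → ∃[ M ] IsCopoint e M × Y ⊆ M
    copoint-above {e} {Y} = grow (⊃-wellFounded Y)
      where
      grow : ∀ {Y} → Acc (flip _⊂_) Y → IsClosed τ Y → e ∉ Y → ∃[ M ] IsCopoint e M × Y ⊆ M
      grow {Y} (acc rec) Y-closed e∉Y with any? (λ f → (f ∈? cov τ Y) ×-dec ¬? (f ≟ e))
      ... | yes (f , f∈cov , f≢e) =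
        let f∉Y , Yf-closed = ∈cov⁻ f∈cov
            e∉Yf = λ e∈ → [ e∉Y , (λ e∈⁅f⁆ → f≢e (sym (x∈⁅y⁆⇒x≡y f e∈⁅f⁆))) ]′ (x∈p∪q⁻ Y ⁅ f ⁆ e∈)
            M , copoint , Yf⊆M = grow
              (rec (p⊆p∪q ⁅ f ⁆ , f , q⊆p∪q Y ⁅ f ⁆ (x∈⁅x⁆ f) , f∉Y)) Yf-closed e∉Yf
        in M , copoint , ⊆-trans (p⊆p∪q ⁅ f ⁆) Yf⊆M
      ... | no ¬other = Y , (Y-closed , ⊆-antisym cov⊆⁅e⁆ (⁅⁆⊆ e∈cov)) , ⊆-refl
        where
        ∈cov⇒≡e : ∀ {f} → f ∈ cov τ Y → f ≡ e
        ∈cov⇒≡e {f} f∈cov = decidable-stable (f ≟ e) λ f≢e → ¬other (f , f∈cov , f≢e)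
        cov⊆⁅e⁆ : cov τ Y ⊆ ⁅ e ⁆
        cov⊆⁅e⁆ f∈cov = subst (_∈ ⁅ e ⁆) (sym (∈cov⇒≡e f∈cov)) (x∈⁅x⁆ e)
        e∈cov : e ∈ cov τ Y
        e∈cov = let f , f∈cov = cov-nonempty Y-closed e∉Y
                in subst (_∈ cov τ Y) (∈cov⇒≡e f∈cov) f∈cov

    copoint-unique : ∀ {e M N} → IsCopoint e M → IsCopoint e N → M ≡ N
    copoint-unique {M = M} {N} (M-closed , covM) (N-closed , covN) =
      injective {M , M-closed} {N , N-closed} (cong τ (trans covM (sym covN)))

    copoint-∈cov : ∀ {e M} → IsCopoint e M → e ∈ cov τ M
    copoint-∈cov {e} (_ , covM) = subst (e ∈_) (sym covM) (x∈⁅x⁆ e)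

    copoint-largest : ∀ {e M Y} → IsCopoint e M → IsClosed τ Y → e ∉ Y → Y ⊆ M
    copoint-largest M-copoint Y-closed e∉Y =
      let N , N-copoint , Y⊆N = copoint-above Y-closed e∉Y
      in subst (_ ⊆_) (copoint-unique N-copoint M-copoint) Y⊆N

    isOrderLike : IsOrderLike
    isOrderLike = record { down-closed = down-closed ; antisym = antisym }
      where
      down-closed : ∀ {S} → bottom ⊆ S → (∀ {x y} → y ∈ S → x ≼ y → x ∈ S) → IsClosed τ S
      down-closed {S} bottom⊆S down = ⊆-antisym
        (λ {e} e∈τS → decidable-stable (e ∈? S) λ e∉S →
          let M , M-copoint@(M-closed , _) , _ =
                copoint-above (idempotent ⊥) (λ e∈ → e∉S (bottom⊆S e∈))
              -- As `S` is down-closed and lacks `e`, each `τ ⁅ y ⁆` with `y` in `S` avoids `e` and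
              -- hence lies in the copoint.
              S⊆M : S ⊆ M
              S⊆M y∈S = copoint-largest M-copoint (idempotent _) (λ e≼y → e∉S (down y∈S e≼y)) ≼-refl
          in proj₁ (∈cov⁻ (copoint-∈cov M-copoint)) (closure-least M-closed S⊆M e∈τS))
        (extensive S)

      antisym : ∀ {x y} → x ∉ bottom → x ≼ y → y ≼ x → x ≡ y
      antisym x∉ x≼y y≼x =
        -- If `y` were in `M`, then `x ≼ y` would put `x` there too. So `y` is outside `M` and below
        -- the cover `x`.
        let M , M-copoint@(M-closed , _) , _ = copoint-above (idempotent ⊥) x∉
            x∈cov = copoint-∈cov M-copoint
        in sym (cov-below x∈cov (λ y∈M → proj₁ (∈cov⁻ x∈cov) (closed-down M-closed y∈M x≼y)) y≼x)

  -- Isomorphism with order ideals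

  closed-lookup : ∀ {X} → IsClosed τ X → closedSets τ (lookup X)
  closed-lookup {X} = subst (IsClosed τ) (sym (tabulate∘lookup X))

  distinguished⁺ : ∀ {e} → e ∉ bottom → Distinguished (closedSets τ) e
  distinguished⁺ {e} e∉ =
    (lookup (τ ⁅ e ⁆) , closed-lookup (idempotent _) , ∈-lookup⁺ (τ ⁅ e ⁆) ≼-refl) ,
    (lookup bottom , closed-lookup (idempotent _) , e∉ ∘ ∈-lookup⁻ bottom)

  distinguished⁻ : ∀ {e} → Distinguished (closedSets τ) e → e ∉ bottom
  distinguished⁻ (_ , Y , Y-closed , e∉Y) e∈ = e∉Y (∈-tabulate⁻ Y (bottom-least Y-closed e∈))

  -- The test set is `τ ⁅ e ⁆`, the least closed set containing `e`.
  inseparable⇒≼ : ∀ {Z e f} → Inseparable (closedSets τ) Z → e ∈ₛ Z → f ∈ₛ Z → f ≼ e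
  inseparable⇒≼ {e = e} inseparable e∈Z f∈Z = ∈-lookup⁻ (τ ⁅ e ⁆)
    (inseparable e∈Z (closed-lookup (idempotent _)) (∈-lookup⁺ (τ ⁅ e ⁆) ≼-refl) f∈Z)

  -- `P` is the complement of `bottom` ordered by `≼`; its ideals are the closed sets with `bottom`
  -- cut off.
  orderLike⇒isomorphic : IsOrderLike → IsomorphicToOrderIdeals (closedSets τ)
  orderLike⇒isomorphic isOrderLike =
    P , _≤_ , isPartialOrder , E₁ , E₂ , essential₁ , essential₂ , φ , λ S → mk⇔ (to S) (from S)
    where
    open IsOrderLike isOrderLike

    outside? : ∀ e → Dec (e ∉ bottom)
    outside? e = ¬? (e ∈? bottom)

    E₁ : 2^ Fin n
    E₁ e = does (outside? e)

    P : Set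
    P = Elem E₁

    P-≡ : {p q : P} → proj₁ p ≡ proj₁ q → p ≡ q
    P-≡ {e , s} {_ , t} refl = cong (e ,_) (T-irrelevant s t)

    ∉bottom : (p : P) → proj₁ p ∉ bottom
    ∉bottom (e , e∈E₁) = does⁻ (outside? e) e∈E₁

    _≤_ : Rel P 0ℓ
    p ≤ q = proj₁ p ≼ proj₁ q

    isPartialOrder : IsPartialOrder _≡_ _≤_
    isPartialOrder = record
      { isPreorder = record
        { isEquivalence = isEquivalence
        ; reflexive     = λ { refl → ≼-refl }
        ; trans         = ≼-trans
        }
      ; antisym = λ {p} p≤q q≤p → P-≡ (antisym (∉bottom p) p≤q q≤p)
      }

    E₂ : 2^ P
    E₂ _ = true

    φ : Elem E₁ ↔ Elem E₂
    φ = mk↔ₛ′ (_, tt) proj₁ (λ _ → refl) (λ _ → refl)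

    essential₁ : IsEssentialization (closedSets τ) E₁
    essential₁ = record
      { distinguished = λ e∈E₁ → distinguished⁺ (∉bottom (_ , e∈E₁))
      -- Antisymmetry forces every block into `bottom`, where nothing is distinguished, so any
      -- element can serve as the retained one.
      ; block         = λ {Z} isBlock →
          let open IsBlock isBlock
              e , f , e∈Z , f∈Z , e≢f = size>1
              e∈bottom = decidable-stable (e ∈? bottom) λ e∉ →
                e≢f (antisym e∉ (inseparable⇒≼ inseparable f∈Z e∈Z)
                                (inseparable⇒≼ inseparable e∈Z f∈Z))
          in e , e∈Z
             , (λ {g} g∈Z _ g∈E₁ → ∉bottom (g , g∈E₁)
                  (closed-down (idempotent ⊥) e∈bottom (inseparable⇒≼ inseparable e∈Z g∈Z)))
             , λ dist → contradiction e∈bottom (distinguished⁻ dist)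
      ; others        = λ {e} dist _ → does⁺ (outside? e) (distinguished⁻ dist)
      }

    principal : P → 2^ P
    principal p q = does (proj₁ q ≼? proj₁ p)

    principal-ideal : ∀ p → orderIdeals _≤_ (principal p)
    principal-ideal p {x} {y} y≤p x≤y =
      does⁺ (proj₁ x ≼? proj₁ p) (≼-trans x≤y (does⁻ (proj₁ y ≼? proj₁ p) y≤p))

    inseparable⇒≤ : ∀ {Z p q} → Inseparable (orderIdeals _≤_) Z → p ∈ₛ Z → q ∈ₛ Z → q ≤ p
    inseparable⇒≤ {p = p} {q} inseparable p∈Z q∈Z = does⁻ (proj₁ q ≼? proj₁ p)
      (inseparable p∈Z (λ {x} {y} → principal-ideal p {x} {y})
        (does⁺ (proj₁ p ≼? proj₁ p) ≼-refl) q∈Z)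

    -- Nothing is removed: the full and the empty ideal distinguish every element, and principal
    -- ideals rule out blocks.
    essential₂ : IsEssentialization (orderIdeals _≤_) E₂
    essential₂ = record
      { distinguished = λ _ →
          (const true , (λ _ _ → tt) , tt) , (const false , (λ ()) , λ ())
      ; block         = λ isBlock →
          let open IsBlock isBlock
              p , q , p∈Z , q∈Z , p≢q = size>1
          in contradiction
               (IsPartialOrder.antisym isPartialOrder
                 (inseparable⇒≤ inseparable q∈Z p∈Z) (inseparable⇒≤ inseparable p∈Z q∈Z))
               p≢q
      ; others        = λ _ _ → tt
      }

    to : ∀ S → imageFamily φ (closedSets τ ↾ E₁) S → (orderIdeals _≤_ ↾ E₂) S
    to S (X , (W , W-closed , X≗W) , S≗X) =
      W ∘ proj₁ ,
      (λ y∈W x≤y → ∈-tabulate⁻ W (closed-down W-closed (∈-tabulate⁺ W y∈W) x≤y)) ,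
      λ s → trans (S≗X s) (X≗W (proj₁ s))

    from : ∀ S → (orderIdeals _≤_ ↾ E₂) S → imageFamily φ (closedSets τ ↾ E₁) S
    from S (I , I-ideal , S≗I) = I , (W , W-closed , I≗W) , S≗I
      where
      -- Vacuous on τ ∅, so this is the closed set I ∪ τ ∅.
      I-outside : Fin n → Set
      I-outside e = (e∈E₁ : e ∈ₛ E₁) → (e , e∈E₁) ∈ₛ I

      I-outside? : Decidable I-outside
      I-outside? e with T? (E₁ e)
      ... | no e∉E₁  = yes λ e∈E₁ → contradiction e∈E₁ e∉E₁
      ... | yes e∈E₁ = map′
        (λ e∈I _ → subst (_∈ₛ I) (P-≡ refl) e∈I) (_$ e∈E₁) (T? (I (e , e∈E₁)))

      W : 2^ Fin n
      W = does ∘ I-outside?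

      I≗W : I ≗ W ∘ proj₁
      I≗W p = does-⇔ (mk⇔ (λ p∈I _ → subst (_∈ₛ I) (P-≡ {p} refl) p∈I) (_$ proj₂ p))
                     (T? (I p)) (I-outside? (proj₁ p))

      W-closed : closedSets τ W
      W-closed = down-closed
        (λ e∈ → ∈-comprehension⁺ I-outside? λ e∈E₁ → contradiction e∈ (∉bottom (_ , e∈E₁)))
        (λ {x} {y} y∈W x≼y → ∈-comprehension⁺ I-outside? λ x∈E₁ →
          let y∉ = λ y∈ → ∉bottom (x , x∈E₁) (closed-down (idempotent ⊥) y∈ x≼y)
          in I-ideal (∈-comprehension⁻ I-outside? y∈W (does⁺ (outside? y) y∉)) x≼y)

  -- Unions of closed sets

  module FromUnions
    (∪-closed : ∀ {X Y} → IsClosed τ X → IsClosed τ Y → IsClosed τ (X ∪ Y)) where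

    -- Starting from `bottom`, a closed subset of `S` absorbs `τ ⁅ x ⁆` for a missing `x` until it
    -- is all of `S`.
    down-closed : ∀ {S} → bottom ⊆ S → (∀ {x y} → y ∈ S → x ≼ y → x ∈ S) → IsClosed τ S
    down-closed {S} bottom⊆S down = exhaust (⊃-wellFounded bottom) (idempotent ⊥) bottom⊆S
      where
      exhaust : ∀ {W} → Acc (flip _⊂_) W → IsClosed τ W → W ⊆ S → IsClosed τ S
      exhaust {W} (acc rec) W-closed W⊆S with S ⊆? W
      ... | yes S⊆W = subst (IsClosed τ) (⊆-antisym W⊆S S⊆W) W-closed
      ... | no S⊈W  =
        let x , x∈S , x∉W = ⊈⇒∃ S⊈W
        in exhaust (rec (p⊆p∪q (τ ⁅ x ⁆) , x , q⊆p∪q W (τ ⁅ x ⁆) ≼-refl , x∉W))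
                   (∪-closed W-closed (idempotent _))
                   (λ z∈ → [ W⊆S , down x∈S ]′ (x∈p∪q⁻ W (τ ⁅ x ⁆) z∈))

  -- Order structure from an isomorphism with order ideals

  module FromIsomorphism (noDoubled : NoDoubledElements (closedSets τ)) where

    -- Closed sets contain the `≼`-equivalence class of `x` entirely or not at all, so the class is
    -- inseparable and `noDoubled` collapses it.
    antisym : ∀ {x y} → x ∉ bottom → x ≼ y → y ≼ x → x ≡ y
    antisym {x} {y} x∉ x≼y y≼x = noDoubled {Z} Z-inseparable
      (does⁺ (equivalent? x) (≼-refl , ≼-refl)) (does⁺ (equivalent? y) (x≼y , y≼x)) (distinguished⁺ x∉)
      where
      equivalent? : Decidable (λ z → x ≼ z × z ≼ x)
      equivalent? z = (x ≼? z) ×-dec (z ≼? x)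
      Z : 2^ Fin n
      Z = does ∘ equivalent?
      Z-inseparable : Inseparable (closedSets τ) Z
      Z-inseparable {e} {W} e∈Z W-closed e∈W {f} f∈Z =
        let x≼e , _ = does⁻ (equivalent? e) e∈Z
            _ , f≼x = does⁻ (equivalent? f) f∈Z
        in ∈-tabulate⁻ W (closed-down W-closed (∈-tabulate⁺ W e∈W) (≼-trans f≼x x≼e))

    -- Unions of ideals are ideals, and the isomorphism carries this over to traces of closed sets
    -- on `E₁`. A trace determines its closed set, as `E₁` misses only elements of `bottom`.
    ∪-closed : IsomorphicToOrderIdeals (closedSets τ) →
               ∀ {X Y} → IsClosed τ X → IsClosed τ Y → IsClosed τ (X ∪ Y)
    ∪-closed (_ , _≤_ , _ , E₁ , E₂ , essential₁ , _ , φ , iso) {X} {Y} X-closed Y-closed =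
      X∪Y-closed
      where
      open Inverse φ using (to; from; strictlyInverseʳ)

      ideal : ∀ {V} → IsClosed τ V → (orderIdeals _≤_ ↾ E₂) (lookup V ∘ proj₁ ∘ from)
      ideal {V} V-closed = Equivalence.to (iso _)
        (lookup V ∘ proj₁ , (lookup V , closed-lookup V-closed , λ _ → refl) , λ _ → refl)

      -- A block through `e` would consist of `e` alone by `noDoubled`, against its size.
      ∉bottom⇒∈E₁ : ∀ {e} → e ∉ bottom → e ∈ₛ E₁
      ∉bottom⇒∈E₁ {e} e∉ = IsEssentialization.others essential₁ (distinguished⁺ e∉) λ {Z} isBlock e∈Z →
        let open IsBlock isBlock
            f , g , f∈Z , g∈Z , f≢g = size>1
            equal : ∀ {h} → h ∈ₛ Z → e ≡ h
            equal = λ h∈Z → noDoubled inseparable e∈Z h∈Z (distinguished⁺ e∉)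
        in f≢g (trans (sym (equal f∈Z)) (equal g∈Z))

      X∪Y-closed : IsClosed τ (X ∪ Y)
      X∪Y-closed
        with I , I-ideal , X≗I ← ideal X-closed
           | J , J-ideal , Y≗J ← ideal Y-closed
        with S , (W , W-closed , S≗W) , I∪J≗S ← Equivalence.from (iso _)
               ( (λ p → I p ∨ J p)
               , (λ y∈ x≤y → Equivalence.from T-∨
                    (Sum.map (λ y∈I → I-ideal y∈I x≤y) (λ y∈J → J-ideal y∈J x≤y)
                      (Equivalence.to T-∨ y∈)))
               , λ _ → refl)
        = subst (IsClosed τ) (sym (trans (sym (tabulate∘lookup (X ∪ Y))) (tabulate-cong agree))) W-closed
        where
        open ≡-Reasoning

        agreeE₁ : (e : Elem E₁) → lookup X (proj₁ e) ∨ lookup Y (proj₁ e) ≡ W (proj₁ e)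
        agreeE₁ e = begin
          lookup X (proj₁ e) ∨ lookup Y (proj₁ e)
            ≡⟨ cong (λ d → lookup X (proj₁ d) ∨ lookup Y (proj₁ d)) (strictlyInverseʳ e) ⟨
          lookup X (proj₁ (from (to e))) ∨ lookup Y (proj₁ (from (to e)))
            ≡⟨ cong₂ _∨_ (X≗I (to e)) (Y≗J (to e)) ⟩
          I (proj₁ (to e)) ∨ J (proj₁ (to e))
            ≡⟨ I∪J≗S (to e) ⟩
          S (from (to e))
            ≡⟨ cong S (strictlyInverseʳ e) ⟩
          S e
            ≡⟨ S≗W e ⟩
          W (proj₁ e) ∎

        -- The isomorphism is silent about `bottom`, but both sets contain it.
        agree : lookup (X ∪ Y) ≗ W
        agree e with e ∈? bottom
        ... | yes e∈ = trans
          ([]=⇒lookup (p⊆p∪q Y (bottom-least X-closed e∈)))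
          (sym (Equivalence.to T-≡ (∈-tabulate⁻ W (bottom-least W-closed e∈))))
        ... | no e∉ = trans (lookup-zipWith _∨_ e X Y) (agreeE₁ (e , ∉bottom⇒∈E₁ e∉))

    isOrderLike : IsomorphicToOrderIdeals (closedSets τ) → IsOrderLike
    isOrderLike isomorphic = record
      { down-closed = FromUnions.down-closed (∪-closed isomorphic) ; antisym = antisym }

theorem4p8 : (n : ℕ) (τ : Subset n → Subset n) (isClosure : IsClosureOperator τ) →
    (CoverClosureBijective isClosure → IsomorphicToOrderIdeals (closedSets τ))
    × (NoDoubledElements (closedSets τ) →
    IsomorphicToOrderIdeals (closedSets τ) → CoverClosureBijective isClosure)
theorem4p8 n τ isClosure =
  (λ (injective , _) → orderLike⇒isomorphic
    (FromInjective.isOrderLike λ {X} {Y} → injective {X} {Y})) ,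
  λ noDoubled isomorphic → FromOrderLike.bijective (FromIsomorphism.isOrderLike noDoubled isomorphic)
  where open Closure isClosure
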